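{- Let $s\ge0$ be an integer, $h\in\mathbb C\setminus\{0\}$ and $q\in\mathbb C\setminus\{0\}$. For all integers $n,k\ge1$, $$S_{s,h,q}[n,k]=\sum_{r=k-1}^{n-1}h^{n-r-1}q^r\genfrac{[}{]}{0pt}{}{n-1}{r}_{q^s}S_{s,h,q}[r,k-1]\prod_{i=0}^{n-r-2}[1+si]_q .$$ Furthermore, for all $n\ge1$, $$B_{s,h,q}[n]=\sum_{r=0}^{n-1}h^{n-r-1}q^r\genfrac{[}{]}{0pt}{}{n-1}{r}_{q^s}B_{s,h,q}[r]\prod_{i=0}^{n-r-2}[1+si]_q .$$
   Context: For an integer $x$, $[x]_q=\frac{q^x-1}{q-1}$ if $q\ne1$ and $[x]_1=x$. $\genfrac{[}{]}{0pt}{}{n}{k}_p$ is the Gaussian ($p$-binomial) coefficient, understood as a polynomial in $p$ evaluated at the given value. The numbers $S_{s,h,q}[n,k]$ are the coefficients in $(VU)^n=\sum_{k=0}^nS_{s,h,q}[n,k]V^{sn-(s-1)k}U^k$, where $UV-qVU=hV^s$; equivalently they are determined by $S_{s,h,q}[n,k]=q^{s(n-1)-(s-1)(k-1)}S_{s,h,q}[n-1,k-1]+h[s(n-1)-(s-1)k]_q\,S_{s,h,q}[n-1,k]$ for $n,k\ge1$, with $S_{s,h,q}[n,0]=S_{s,h,q}[0,n]=\delta_{0,n}$. The generalized $q$-Bell numbers are $B_{s,h,q}[n]=\sum_{k=0}^nS_{s,h,q}[n,k]$. Empty products equal $1$, empty sums equal $0$. -}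

module Defs where

open import Algebra.Apartness.Bundles using (HeytingField; HeytingCommutativeRing)
open import Algebra.Bundles using (CommutativeRing; CommutativeSemiring)
open import Data.Fin.Base using (toℕ)
open import Data.Integer.Base as ℤ using (ℤ; +_; -[1+_])
open import Data.Nat.Base as ℕ using (ℕ; zero; suc)
import Data.Nat.Properties as ℕₚ
open import Data.Product.Base using (proj₁)
open import Data.Sum.Base using (_⊎_; inj₁; inj₂)
open import Relation.Binary.PropositionalEquality as ≡ using (_≡_)

module Gaussian {c ℓ} (R : CommutativeSemiring c ℓ)
                (p : CommutativeSemiring.Carrier R) where

  open CommutativeSemiring R
  open import Algebra.Definitions.RawSemiring rawSemiring using (_^_; sum)
  open import Algebra.Properties.Semiring.Sum semiring
    using (sum-cong-≋; *-distribˡ-sum)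
  open import Algebra.Properties.CommutativeSemigroup *-commutativeSemigroup
    using (x∙yz≈y∙xz)
  open import Relation.Binary.Reasoning.Setoid setoid

  -- The q-Pascal recursion gives a polynomial in p with coefficients in ℕ,
  -- so it also makes sense when p is a root of unity, where the quotient
  -- [n]! / ([k]! [n-k]!) does not.  That it is this quotient is
  -- `gaussian-factorial`, valid in every commutative semiring and hence
  -- in particular for the polynomial indeterminate.
  gaussian : ℕ → ℕ → Carrier
  gaussian n       zero    = 1#
  gaussian zero    (suc k) = 0#
  gaussian (suc n) (suc k) = gaussian n k + p ^ suc k * gaussian n (suc k)

  qNat : ℕ → Carrier
  qNat m = sum {m} (λ i → p ^ toℕ i)

  qFactorial : ℕ → Carrier
  qFactorial zero    = 1#
  qFactorial (suc m) = qNat (suc m) * qFactorial m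

  private
    qNat-suc : ∀ m → qNat (suc m) ≈ 1# + p * qNat m
    qNat-suc m = +-congˡ (sym (*-distribˡ-sum {m} p (λ i → p ^ toℕ i)))

    qNat-+ : ∀ k j → qNat (k ℕ.+ j) ≈ qNat k + p ^ k * qNat j
    qNat-+ zero    j = sym (trans (+-identityˡ _) (*-identityˡ _))
    qNat-+ (suc k) j = begin
      qNat (suc (k ℕ.+ j))                      ≈⟨ qNat-suc (k ℕ.+ j) ⟩
      1# + p * qNat (k ℕ.+ j)                   ≈⟨ +-congˡ (*-congˡ (qNat-+ k j)) ⟩
      1# + p * (qNat k + p ^ k * qNat j)        ≈⟨ +-congˡ (distribˡ _ _ _) ⟩
      1# + (p * qNat k + p * (p ^ k * qNat j))  ≈⟨ +-assoc _ _ _ ⟨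
      1# + p * qNat k + p * (p ^ k * qNat j)    ≈⟨ +-cong (qNat-suc k) (*-assoc _ _ _) ⟨
      qNat (suc k) + p ^ suc k * qNat j         ∎

    gaussian-> : ∀ {n k} → n ℕ.< k → gaussian n k ≈ 0#
    gaussian-> {zero}  {suc k} _ = refl
    gaussian-> {suc n} {suc k} (ℕ.s≤s n<k) = begin
      gaussian n k + p ^ suc k * gaussian n (suc k)
        ≈⟨ +-cong (gaussian-> n<k) (*-congˡ (gaussian-> (ℕₚ.m<n⇒m<1+n n<k))) ⟩
      0# + p ^ suc k * 0#  ≈⟨ +-identityˡ _ ⟩
      p ^ suc k * 0#       ≈⟨ zeroʳ _ ⟩
      0#                   ∎

    gaussian-diagonal : ∀ k → gaussian k k ≈ 1#
    gaussian-diagonal zero    = refl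
    gaussian-diagonal (suc k) = begin
      gaussian k k + p ^ suc k * gaussian k (suc k)
        ≈⟨ +-cong (gaussian-diagonal k) (*-congˡ (gaussian-> (ℕₚ.n<1+n k))) ⟩
      1# + p ^ suc k * 0#  ≈⟨ +-congˡ (zeroʳ _) ⟩
      1# + 0#              ≈⟨ +-identityʳ _ ⟩
      1#                   ∎

  gaussian-factorial : ∀ j k →
    gaussian (j ℕ.+ k) k * (qFactorial k * qFactorial j) ≈ qFactorial (j ℕ.+ k)
  gaussian-factorial zero k = begin
    gaussian k k * (qFactorial k * 1#)  ≈⟨ *-cong (gaussian-diagonal k) (*-identityʳ _) ⟩
    1# * qFactorial k                   ≈⟨ *-identityˡ _ ⟩
    qFactorial k                        ∎
  gaussian-factorial (suc j) zero = begin
    1# * (1# * qFactorial (suc j))  ≈⟨ trans (*-identityˡ _) (*-identityˡ _) ⟩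
    qFactorial (suc j)              ≡⟨ ≡.cong qFactorial (ℕₚ.+-identityʳ (suc j)) ⟨
    qFactorial (suc j ℕ.+ 0)        ∎
  gaussian-factorial (suc j) (suc k) = begin
    (G₁ + p ^ suc k * G₂) * (A * B * (C * D))
      ≈⟨ distribʳ _ _ _ ⟩
    G₁ * (A * B * (C * D)) + p ^ suc k * G₂ * (A * B * (C * D))
      ≈⟨ +-cong left right ⟩
    A * N! + p ^ suc k * C * N!
      ≈⟨ distribʳ _ _ _ ⟨
    (A + p ^ suc k * C) * N!
      ≈⟨ *-congʳ (qNat-+ (suc k) (suc j)) ⟨
    qNat (suc k ℕ.+ suc j) * N!
      ≡⟨ ≡.cong (λ m → qNat m * N!) (ℕₚ.+-comm (suc k) (suc j)) ⟩
    qNat (suc j ℕ.+ suc k) * N!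
      ∎
    where
    G₁ = gaussian (j ℕ.+ suc k) k
    G₂ = gaussian (j ℕ.+ suc k) (suc k)
    A  = qNat (suc k)
    B  = qFactorial k
    C  = qNat (suc j)
    D  = qFactorial j
    N! = qFactorial (j ℕ.+ suc k)

    shifted : G₁ * (B * (C * D)) ≈ N!
    shifted = ≡.subst (λ m → gaussian m k * (B * (C * D)) ≈ qFactorial m)
                      (≡.sym (ℕₚ.+-suc j k)) (gaussian-factorial (suc j) k)

    left : G₁ * (A * B * (C * D)) ≈ A * N!
    left = begin
      G₁ * (A * B * (C * D))    ≈⟨ *-congˡ (*-assoc _ _ _) ⟩
      G₁ * (A * (B * (C * D)))  ≈⟨ x∙yz≈y∙xz _ _ _ ⟩
      A * (G₁ * (B * (C * D)))  ≈⟨ *-congˡ shifted ⟩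
      A * N!                    ∎

    right : p ^ suc k * G₂ * (A * B * (C * D)) ≈ p ^ suc k * C * N!
    right = begin
      p ^ suc k * G₂ * (A * B * (C * D))    ≈⟨ *-assoc _ _ _ ⟩
      p ^ suc k * (G₂ * (A * B * (C * D)))  ≈⟨ *-congˡ (*-congˡ (x∙yz≈y∙xz _ _ _)) ⟩
      p ^ suc k * (G₂ * (C * (A * B * D)))  ≈⟨ *-congˡ (x∙yz≈y∙xz _ _ _) ⟩
      p ^ suc k * (C * (G₂ * (A * B * D)))  ≈⟨ *-congˡ (*-congˡ (gaussian-factorial j (suc k))) ⟩
      p ^ suc k * (C * N!)                  ≈⟨ *-assoc _ _ _ ⟨
      p ^ suc k * C * N!                    ∎

module OverField {c ℓ₁ ℓ₂} (K : HeytingField c ℓ₁ ℓ₂) where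

  open HeytingField K
  open HeytingCommutativeRing heytingCommutativeRing using (commutativeRing)
  open CommutativeRing commutativeRing using (commutativeSemiring)
  open CommutativeSemiring commutativeSemiring using (rawSemiring)
  open import Algebra.Definitions.RawSemiring rawSemiring public
    using (_^_)
  open import Algebra.Definitions.RawSemiring rawSemiring
    using (_×_; sum; product)

  infixl 10 ∑-syntax ∏-syntax

  ∑-syntax : ℕ → ℕ → (ℕ → Carrier) → Carrier
  ∑-syntax a b f = sum {b ℕ.∸ a} (λ i → f (a ℕ.+ toℕ i))

  syntax ∑-syntax a b (λ r → x) = ∑[ a ≤ r < b ] x

  ∏-syntax : ℕ → (ℕ → Carrier) → Carrier
  ∏-syntax n f = product {n} (λ i → f (toℕ i))

  syntax ∏-syntax n (λ i → x) = ∏[ i < n ] x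

  fromℤ : ℤ → Carrier
  fromℤ (+ n)    = n × 1#
  fromℤ -[1+ n ] = - (suc n × 1#)

  -- `#⇒invertible x#0` inverts x - 0#, which is x.
  inverse : ∀ {x} → x # 0# → Carrier
  inverse x#0 = proj₁ (#⇒invertible x#0)

  zpow : ∀ x → x # 0# → ℤ → Carrier
  zpow x x#0 (+ n)    = x ^ n
  zpow x x#0 -[1+ n ] = inverse x#0 ^ suc n

  -- The case distinction q = 1 / q ≠ 1 is an argument, since in a field such as
  -- ℂ it cannot be decided constructively.
  module GeneralizedStirling
    (s : ℕ) (h q : Carrier) (q#0 : q # 0#) (q≟1 : q ≈ 1# ⊎ q # 1#) where

    open Gaussian commutativeSemiring public using (gaussian)

    qNumber : q ≈ 1# ⊎ q # 1# → ℤ → Carrier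
    qNumber (inj₁ q≈1) x = fromℤ x
    qNumber (inj₂ q#1) x = (zpow q q#0 x - 1#) * proj₁ (#⇒invertible q#1)

    [_]q : ℤ → Carrier
    [ x ]q = qNumber q≟1 x

    -- The coefficients in (VU)ⁿ = Σₖ S n k V^(sn-(s-1)k) Uᵏ, where UV - qVU = hVˢ,
    -- given by their recurrence.  The exponent of q and the argument of [_]q can
    -- be negative, but only when the factor from S they multiply is zero.
    S : ℕ → ℕ → Carrier
    S zero    zero    = 1#
    S zero    (suc k) = 0#
    S (suc n) zero    = 0#
    S (suc n) (suc k) =
        zpow q q#0 (+ s ℤ.* + n ℤ.- (+ s ℤ.- + 1) ℤ.* + k) * S n k
      + h * [ + s ℤ.* + n ℤ.- (+ s ℤ.- + 1) ℤ.* + suc k ]q * S n (suc k)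

    B : ℕ → Carrier
    B n = ∑[ 0 ≤ k < suc n ] S n k

{-# OPTIONS --safe #-}

-- Put c N r = h^(N-r) q^r [N, r]_{q^s} ∏_{i<N-r} [1+si]_q.  The Pascal rule
-- [N+1, r+1]_p = p^(N-r) [N, r]_p + [N, r+1]_p  turns ∑ᵣ c (N+1) r · S r k into
-- ∑ᵣ c N r · (q^(1+s(N-r)) S (r+1) k + h [1+s(N-r)]_q S r k).  Expand S (r+1) k
-- by its recurrence: since [a+b]_q = [a]_q + q^a [b]_q, the factors depending on
-- r combine into factors depending only on N and k.  Hence the right-hand side
-- obeys the recurrence of S; the identity for B is its sum over k.
module Submission where

open import Defs
open import Algebra.Apartness.Bundles using (HeytingField; HeytingCommutativeRing)
open import Algebra.Bundles using (CommutativeRing; CommutativeSemiring; Monoid)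
open import Data.Fin.Base using (toℕ)
open import Data.Fin.Properties using (toℕ<n; toℕ-fromℕ; toℕ-inject₁)
open import Data.Integer.Base as ℤ using (ℤ; +_; -[1+_])
import Data.Integer.Properties as ℤₚ
open import Data.Integer.Solver using (module +-*-Solver)
open import Data.Nat.Base as ℕ using (ℕ; zero; suc; _∸_; z≤n; s≤s)
import Data.Nat.Properties as ℕₚ
open import Data.Product.Base using (_×_; _,_; proj₁; proj₂)
open import Data.Sum.Base using (_⊎_; inj₁; inj₂)
open import Function.Base using (_∘_)
open import Relation.Binary.PropositionalEquality as ≡ using (_≡_)
open import Relation.Nullary using (yes; no)

-- Finite sums in a monoid, serving both sums and products in the field.

module RangeSum {c ℓ} (M : Monoid c ℓ) where
  open Monoid M
  open import Algebra.Properties.Monoid.Sum M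
    using (sum; sum-cong-≋; sum-init-last; sum-cong-≗)

  ∑< : ℕ → (ℕ → Carrier) → Carrier
  ∑< n f = sum {n} (f ∘ toℕ)

  ∑<-cong : ∀ n {f g} → (∀ r → r ℕ.< n → f r ≈ g r) → ∑< n f ≈ ∑< n g
  ∑<-cong n f≈g = sum-cong-≋ {n} (λ i → f≈g (toℕ i) (toℕ<n i))

  ∑<-last : ∀ n f → ∑< (suc n) f ≈ ∑< n f ∙ f n
  ∑<-last n f = trans (sum-init-last {n} (f ∘ toℕ))
    (∙-cong (reflexive (sum-cong-≗ {n} (λ i → ≡.cong f (toℕ-inject₁ i))))
            (reflexive (≡.cong f (toℕ-fromℕ n))))

  ∑<-zero : ∀ n {f} → (∀ r → f r ≈ ε) → ∑< n f ≈ ε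
  ∑<-zero zero    f≈ε = refl
  ∑<-zero (suc n) f≈ε =
    trans (∙-cong (f≈ε 0) (∑<-zero n (f≈ε ∘ suc))) (identityˡ ε)

  ∑<-drop : ∀ a b f → (∀ r → r ℕ.< a → f r ≈ ε) →
            ∑< b f ≈ ∑< (b ∸ a) (λ i → f (a ℕ.+ i))
  ∑<-drop zero    b       f _   = refl
  ∑<-drop (suc a) zero    f _   = refl
  ∑<-drop (suc a) (suc b) f f≈ε =
    trans (∙-cong (f≈ε 0 (s≤s z≤n))
                  (∑<-drop a b (f ∘ suc) (λ r r<a → f≈ε (suc r) (s≤s r<a))))
          (identityˡ _)

  ∑<-truncate : ∀ {m n} f → m ℕ.≤ n → (∀ r → m ℕ.≤ r → f r ≈ ε) →
                ∑< n f ≈ ∑< m f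
  ∑<-truncate {n = n} f z≤n f≈ε = ∑<-zero n (λ r → f≈ε r z≤n)
  ∑<-truncate f (s≤s m≤n) f≈ε =
    ∙-congˡ (∑<-truncate (f ∘ suc) m≤n (λ r m≤r → f≈ε (suc r) (s≤s m≤r)))

-- The second Pascal rule for Gaussian coefficients.

module GaussianPascal {c ℓ} (R : CommutativeSemiring c ℓ)
                      (p : CommutativeSemiring.Carrier R) where
  open CommutativeSemiring R
  open Gaussian R p using (gaussian)
  open import Algebra.Definitions.RawSemiring rawSemiring using (_^_)
  open import Algebra.Solver.Ring.NaturalCoefficients.Default R
  open import Relation.Binary.Reasoning.Setoid setoid

  gaussian-> : ∀ {n k} → n ℕ.< k → gaussian n k ≈ 0#
  gaussian-> {zero}  {suc k} _ = refl
  gaussian-> {suc n} {suc k} (s≤s n<k) = trans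
    (+-cong (gaussian-> n<k)
            (trans (*-congˡ (gaussian-> (ℕₚ.m<n⇒m<1+n n<k))) (zeroʳ _)))
    (+-identityˡ 0#)

  -- For r > n both sides vanish, so the truncated n ∸ r does no harm.
  gaussian-pascal : ∀ n r →
    gaussian (suc n) (suc r) ≈ p ^ (n ∸ r) * gaussian n r + gaussian n (suc r)
  gaussian-pascal zero    zero    = +-cong (sym (*-identityˡ 1#)) (zeroʳ _)
  gaussian-pascal zero    (suc r) = +-cong (sym (*-identityˡ 0#)) (zeroʳ _)
  gaussian-pascal (suc n) zero    = begin
    1# + p * 1# * gaussian (suc n) 1
      ≈⟨ +-congˡ (*-congˡ (gaussian-pascal n 0)) ⟩
    1# + p * 1# * (p ^ n * 1# + gaussian n 1)
      ≈⟨ solve 3 (λ p x g → con 1 :+ p :* con 1 :* (x :* con 1 :+ g)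
                         := p :* x :* con 1 :+ (con 1 :+ p :* con 1 :* g))
               refl p (p ^ n) (gaussian n 1) ⟩
    p * p ^ n * 1# + (1# + p * 1# * gaussian n 1)
      ∎
  gaussian-pascal (suc n) (suc r) = begin
    gaussian (suc n) (suc r) + p ^ suc (suc r) * gaussian (suc n) (suc (suc r))
      ≈⟨ +-cong (gaussian-pascal n r) (*-congˡ (gaussian-pascal n (suc r))) ⟩
    p ^ (n ∸ r) * G₀ + G₁ + p ^ suc (suc r) * (p ^ (n ∸ suc r) * G₁ + G₂)
      ≈⟨ +-congˡ (trans (distribˡ _ _ _) (+-congʳ (sym (*-assoc _ _ _)))) ⟩
    p ^ (n ∸ r) * G₀ + G₁ + (p ^ suc (suc r) * p ^ (n ∸ suc r) * G₁ + p ^ suc (suc r) * G₂)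
      ≈⟨ +-congˡ (+-congʳ exponents) ⟩
    p ^ (n ∸ r) * G₀ + G₁ + (p ^ (n ∸ r) * p ^ suc r * G₁ + p ^ suc (suc r) * G₂)
      -- Regrouped so that both brackets refold by the defining recursion, into
      -- `gaussian (suc n) (suc r)` and `gaussian (suc n) (suc (suc r))`.
      ≈⟨ solve 6 (λ x g₀ g₁ y z g₂ →
             x :* g₀ :+ g₁ :+ (x :* y :* g₁ :+ z :* g₂)
          := x :* (g₀ :+ y :* g₁) :+ (g₁ :+ z :* g₂))
          refl (p ^ (n ∸ r)) G₀ G₁ (p ^ suc r) (p ^ suc (suc r)) G₂ ⟩
    p ^ (n ∸ r) * (G₀ + p ^ suc r * G₁) + (G₁ + p ^ suc (suc r) * G₂)
      ∎
    where
    G₀ = gaussian n r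
    G₁ = gaussian n (suc r)
    G₂ = gaussian n (suc (suc r))

    exponents : p ^ suc (suc r) * p ^ (n ∸ suc r) * G₁ ≈ p ^ (n ∸ r) * p ^ suc r * G₁
    exponents with suc r ℕₚ.≤? n
    -- Here the truncated exponents no longer add up, but `G₁` vanishes because n < r + 1.
    ... | no  r≮n = trans (*-congˡ G₁≈0) (trans (zeroʳ _) (sym (trans (*-congˡ G₁≈0) (zeroʳ _))))
      where G₁≈0 = gaussian-> (ℕₚ.≰⇒> r≮n)
    ... | yes r<n = *-congʳ (begin
      p * p ^ suc r * p ^ (n ∸ suc r)
        ≈⟨ solve 3 (λ p x y → p :* x :* y := p :* y :* x) refl p (p ^ suc r) (p ^ (n ∸ suc r)) ⟩
      p ^ suc (n ∸ suc r) * p ^ suc r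
        ≡⟨ ≡.cong (λ m → p ^ m * p ^ suc r) (≡.sym (ℕₚ.+-∸-assoc 1 r<n)) ⟩
      p ^ (n ∸ r) * p ^ suc r
        ∎)

-- Integer powers of q and q-numbers.

module StirlingRecurrence {c ℓ₁ ℓ₂} (K : HeytingField c ℓ₁ ℓ₂) where
  open HeytingField K
  open HeytingCommutativeRing heytingCommutativeRing using (commutativeRing)
  open CommutativeRing commutativeRing using (commutativeSemiring; semiring; ring)
  open CommutativeSemiring commutativeSemiring using (+-monoid; *-monoid)
  open OverField K
  open import Algebra.Properties.Ring ring using (-0#≈0#; -‿+-comm)
  open import Algebra.Properties.Semiring.Exp semiring using (^-assocʳ)
  open import Algebra.Properties.Semiring.Sum semiring
    using (*-distribˡ-sum; *-distribʳ-sum; ∑-distrib-+; ∑-comm)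
  open import Algebra.Solver.Ring.NaturalCoefficients.Default commutativeSemiring
  open import Relation.Binary.Reasoning.Setoid setoid
  open RangeSum +-monoid
  open RangeSum *-monoid using () renaming (∑<-last to ∏<-last)

  x+[-[x+y]]≈-y : ∀ x y → x + - (x + y) ≈ - y
  x+[-[x+y]]≈-y x y = begin
    x + - (x + y)    ≈⟨ +-congˡ (-‿+-comm x y) ⟨
    x + (- x + - y)  ≈⟨ +-assoc _ _ _ ⟨
    x + - x + - y    ≈⟨ +-congʳ (-‿inverseʳ x) ⟩
    0# + - y         ≈⟨ +-identityˡ _ ⟩
    - y              ∎

  fromℤ-suc : ∀ x → fromℤ (ℤ.suc x) ≈ 1# + fromℤ x
  fromℤ-suc (+ n)        = refl
  fromℤ-suc -[1+ zero ]  = sym (trans (x+[-[x+y]]≈-y 1# 0#) -0#≈0#)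
  fromℤ-suc -[1+ suc n ] = sym (x+[-[x+y]]≈-y 1# _)

  module Column (s : ℕ) (h q : Carrier) (q#0 : q # 0#) (q≟1 : q ≈ 1# ⊎ q # 1#) where
    open GeneralizedStirling s h q q#0 q≟1
    open GaussianPascal commutativeSemiring (q ^ s)

    private
      p = q ^ s
      G = gaussian p

      infixr 8 q^_
      q^_ : ℤ → Carrier
      q^ x = zpow q q#0 x

    q*inverse : q * inverse q#0 ≈ 1#
    q*inverse = trans
      (*-congʳ (sym (trans (+-congˡ -0#≈0#) (+-identityʳ q))))
      (proj₂ (proj₂ (#⇒invertible q#0)))

    zpow-suc : ∀ x → q^ ℤ.suc x ≈ q * q^ x
    zpow-suc (+ n)        = refl
    zpow-suc -[1+ zero ]  = sym (trans (*-congˡ (*-identityʳ _)) q*inverse)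
    zpow-suc -[1+ suc n ] =
      sym (trans (sym (*-assoc _ _ _)) (trans (*-congʳ q*inverse) (*-identityˡ _)))

    -- A natural first summand suffices, as exponents are only ever shifted by 1 + s(n - r).
    -- Induction on it avoids splitting on the sign of `x`.
    zpow-+ : ∀ m x → q^ (+ m ℤ.+ x) ≈ q ^ m * q^ x
    zpow-+ zero    x = trans (reflexive (≡.cong q^_ (ℤₚ.+-identityˡ x))) (sym (*-identityˡ _))
    zpow-+ (suc m) x = begin
      q^ (+ suc m ℤ.+ x)      ≡⟨ ≡.cong q^_ (ℤₚ.suc-+ m x) ⟩
      q^ ℤ.suc (+ m ℤ.+ x)    ≈⟨ zpow-suc (+ m ℤ.+ x) ⟩
      q * q^ (+ m ℤ.+ x)      ≈⟨ *-congˡ (zpow-+ m x) ⟩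
      q * (q ^ m * q^ x)      ≈⟨ *-assoc _ _ _ ⟨
      q ^ suc m * q^ x        ∎

    -- The cases q = 1 and q ≠ 1 are separated only here and in `qNumber-zero`; the later facts on
    -- q-numbers follow from these two.
    qNumber-suc : ∀ d x → qNumber d (ℤ.suc x) ≈ 1# + q * qNumber d x
    qNumber-suc (inj₁ q≈1) x = trans (fromℤ-suc x)
      (+-congˡ (sym (trans (*-congʳ q≈1) (*-identityˡ _))))
    qNumber-suc (inj₂ q#1) x = begin
      (q^ ℤ.suc x - 1#) * i             ≈⟨ *-congʳ (+-congʳ (zpow-suc x)) ⟩
      -- With t = q^x - 1, the numerator q^(x+1) - 1 becomes (q - 1) + qt.
      (q * z - 1#) * i                  ≈⟨ *-congʳ (+-congʳ (*-congˡ z≈t+1)) ⟩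
      (q * (t + 1#) + - 1#) * i         ≈⟨ solve 4 (λ q t m i →
                                             (q :* (t :+ con 1) :+ m) :* i
                                             := (q :+ m) :* i :+ q :* (t :* i))
                                             refl q t (- 1#) i ⟩
      (q - 1#) * i + q * (t * i)        ≈⟨ +-congʳ (proj₂ (proj₂ (#⇒invertible q#1))) ⟩
      1# + q * (t * i)                  ∎
      where
      i = proj₁ (#⇒invertible q#1)
      z = q^ x
      t = z - 1#
      z≈t+1 : z ≈ t + 1#
      z≈t+1 = sym (trans (+-assoc _ _ _)
                  (trans (+-congˡ (-‿inverseˡ 1#)) (+-identityʳ z)))

    qNumber-zero : ∀ d → qNumber d (+ 0) ≈ 0#
    qNumber-zero (inj₁ _) = refl
    qNumber-zero (inj₂ _) = trans (*-congʳ (-‿inverseʳ 1#)) (zeroˡ _)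

    -- Iterates `qNumber-suc`. It later merges the two coefficients of `Y r` in `term-recurrence`.
    qNumber-+ : ∀ m x → [ + m ℤ.+ x ]q ≈ [ + m ]q + q ^ m * [ x ]q
    qNumber-+ zero    x = begin
      [ + 0 ℤ.+ x ]q          ≡⟨ ≡.cong [_]q (ℤₚ.+-identityˡ x) ⟩
      [ x ]q                  ≈⟨ +-identityˡ _ ⟨
      0# + [ x ]q             ≈⟨ +-cong (qNumber-zero q≟1) (*-identityˡ _) ⟨
      [ + 0 ]q + 1# * [ x ]q  ∎
    qNumber-+ (suc m) x = begin
      [ + suc m ℤ.+ x ]q                     ≡⟨ ≡.cong [_]q (ℤₚ.suc-+ m x) ⟩
      [ ℤ.suc (+ m ℤ.+ x) ]q                 ≈⟨ qNumber-suc q≟1 _ ⟩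
      1# + q * [ + m ℤ.+ x ]q                ≈⟨ +-congˡ (*-congˡ (qNumber-+ m x)) ⟩
      1# + q * ([ + m ]q + q ^ m * [ x ]q)
        ≈⟨ solve 4 (λ q a b c → con 1 :+ q :* (a :+ b :* c)
                             := con 1 :+ q :* a :+ q :* b :* c)
                 refl q [ + m ]q (q ^ m) [ x ]q ⟩
      1# + q * [ + m ]q + q ^ suc m * [ x ]q ≈⟨ +-congʳ (qNumber-suc q≟1 (+ m)) ⟨
      [ + suc m ]q + q ^ suc m * [ x ]q      ∎

    -- The exponents in the recurrence of S.

    exponent : ℕ → ℤ → ℤ
    exponent n k = + s ℤ.* + n ℤ.- (+ s ℤ.- + 1) ℤ.* k

    -- The difference of the two exponents is s(n + 1 - r) - (s - 1), free of k; it is also the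
    -- argument of the q-number that `P` gains at its next factor.
    exponent-shift : ∀ {n r} k → r ℕ.≤ n →
      exponent (suc n) (ℤ.suc k) ≡ + (1 ℕ.+ s ℕ.* (n ∸ r)) ℤ.+ exponent r k
    exponent-shift {n} {r} k r≤n = ≡.trans
      -- Once n is written as (n ∸ r) + r, a polynomial identity remains.
      (≡.cong (λ m → + s ℤ.* + suc m ℤ.- (+ s ℤ.- + 1) ℤ.* ℤ.suc k)
              (≡.sym (ℕₚ.m∸n+n≡m r≤n)))
      (≡.trans
        (+-*-Solver.solve 4 (λ s d r k →
           s ⊗ (one ⊕ (d ⊕ r)) ⊖ (s ⊖ one) ⊗ (one ⊕ k)
           ⊜ (one ⊕ s ⊗ d) ⊕ (s ⊗ r ⊖ (s ⊖ one) ⊗ k))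
           ≡.refl (+ s) (+ (n ∸ r)) (+ r) k)
        (≡.cong (λ m → + 1 ℤ.+ m ℤ.+ exponent r k) (≡.sym (ℤₚ.pos-* s (n ∸ r)))))
      where
      open +-*-Solver using ()
        renaming (_:+_ to _⊕_; _:*_ to _⊗_; _:-_ to _⊖_; _:=_ to _⊜_)
      one : ∀ {m} → +-*-Solver.Polynomial m
      one = +-*-Solver.con (+ 1)

    -- Splitting the sum by the Pascal rule.

    P : ℕ → Carrier
    P n = ∏[ i < n ] [ + (1 ℕ.+ s ℕ.* i) ]q

    -- The summand of the theorem, with its n - 1 called `n`. The function `f` will be a column of
    -- S, the zero column or `B`.
    term : (ℕ → Carrier) → ℕ → ℕ → Carrier
    term f n r = h ^ (n ∸ r) * q ^ r * G n r * f r * P (n ∸ r)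

    -- The two parts into which the Pascal rule splits `term f (suc n)`.
    shifted : (ℕ → Carrier) → ℕ → ℕ → Carrier
    shifted f n r = h ^ (n ∸ r) * q ^ suc r * (p ^ (n ∸ r) * G n r) * f (suc r) * P (n ∸ r)

    unshifted : (ℕ → Carrier) → ℕ → ℕ → Carrier
    unshifted f n r = h ^ (suc n ∸ r) * q ^ r * G n r * f r * P (suc n ∸ r)

    term-suc : ∀ f n r → term f (suc n) (suc r) ≈ shifted f n r + unshifted f n (suc r)
    term-suc f n r = trans (*-congʳ (*-congʳ (*-congˡ (gaussian-pascal n r))))
      (solve 5 (λ a x y b c → a :* (x :+ y) :* b :* c
                          := a :* x :* b :* c :+ a :* y :* b :* c) refl _ _ _ _ _)

    -- The Pascal rule yields `unshifted` at indices 1 to n + 1. The head term supplies index 0 and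
    -- the last one vanishes, so both families run over r ≤ n and can be paired at equal r.
    ∑-term-suc : ∀ f n → ∑< (suc (suc n)) (term f (suc n)) ≈
                         ∑< (suc n) (λ r → shifted f n r + unshifted f n r)
    ∑-term-suc f n = begin
      -- `term f (suc n) 0` is `u 0` by definition: both Gaussian coefficients are 1.
      u 0 + ∑< (suc n) (term f (suc n) ∘ suc)
        ≈⟨ +-congˡ (∑<-cong (suc n) (λ r _ → term-suc f n r)) ⟩
      u 0 + ∑< (suc n) (λ r → v r + u (suc r))
        ≈⟨ +-congˡ (∑-distrib-+ {suc n} (v ∘ toℕ) (u ∘ suc ∘ toℕ)) ⟩
      u 0 + (∑< (suc n) v + ∑< (suc n) (u ∘ suc))
        ≈⟨ solve 3 (λ a b c → a :+ (b :+ c) := b :+ (a :+ c)) refl _ _ _ ⟩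
      ∑< (suc n) v + ∑< (suc (suc n)) u
        ≈⟨ +-congˡ (∑<-last (suc n) u) ⟩
      ∑< (suc n) v + (∑< (suc n) u + u (suc n))
        ≈⟨ +-congˡ (trans (+-congˡ u-last) (+-identityʳ _)) ⟩
      ∑< (suc n) v + ∑< (suc n) u
        ≈⟨ ∑-distrib-+ {suc n} (v ∘ toℕ) (u ∘ toℕ) ⟨
      ∑< (suc n) (λ r → v r + u r)
        ∎
      where
      u = unshifted f n
      v = shifted f n
      u-last : u (suc n) ≈ 0#
      u-last = trans (*-congʳ (*-congʳ (*-congˡ (gaussian-> (ℕₚ.n<1+n n)))))
        (solve 3 (λ a b c → a :* con 0 :* b :* c := con 0) refl _ _ _)

    -- The index k is an integer so that k = -1, with X = 0, covers column 0.
    module _ (X Y : ℕ → Carrier) (k : ℤ)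
      (Y-suc : ∀ r → Y (suc r) ≈ q^ exponent r k * X r + h * [ exponent r (ℤ.suc k) ]q * Y r)
      where

      term-recurrence : ∀ {n r} → r ℕ.≤ n → shifted Y n r + unshifted Y n r ≈
        q^ exponent (suc n) (ℤ.suc k) * term X n r
        + h * [ exponent (suc n) (ℤ.suc (ℤ.suc k)) ]q * term Y n r
      term-recurrence {n} {r} r≤n = begin
        shifted Y n r + unshifted Y n r
          -- Since r ≤ n, `suc n ∸ r` is `suc d`, and `P` sheds its last factor `e`.
          ≈⟨ +-cong (*-congʳ (*-congˡ (Y-suc r)))
                    (trans (reflexive (≡.cong
                              (λ m → h ^ m * q ^ r * G n r * Y r * P m)
                              (ℕₚ.+-∸-assoc 1 r≤n)))
                           (*-congˡ (∏<-last d (λ i → [ + (1 ℕ.+ s ℕ.* i) ]q)))) ⟩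
        h ^ d * q ^ suc r * (p ^ d * G n r) * (a * X r + h * b * Y r) * P d
        + h ^ suc d * q ^ r * G n r * Y r * (P d * e)
          ≈⟨ solve 12 (λ h hᵈ q qʳ pᵈ g a x b y π e →
                hᵈ :* (q :* qʳ) :* (pᵈ :* g) :* (a :* x :+ h :* b :* y) :* π
                :+ h :* hᵈ :* qʳ :* g :* y :* (π :* e)
             := q :* pᵈ :* a :* (hᵈ :* qʳ :* g :* x :* π)
                :+ h :* (e :+ q :* pᵈ :* b) :* (hᵈ :* qʳ :* g :* y :* π))
             refl h (h ^ d) q (q ^ r) (p ^ d) (G n r) a (X r) b (Y r) (P d) e ⟩
        q * p ^ d * a * term X n r + h * (e + q * p ^ d * b) * term Y n r
          ≈⟨ +-cong (*-congʳ (sym zpow-exponent)) (*-congʳ (*-congˡ (sym qNumber-exponent))) ⟩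
        q^ exponent (suc n) (ℤ.suc k) * term X n r
        + h * [ exponent (suc n) (ℤ.suc (ℤ.suc k)) ]q * term Y n r
          ∎
        where
        d = n ∸ r
        a = q^ exponent r k
        b = [ exponent r (ℤ.suc k) ]q
        e = [ + (1 ℕ.+ s ℕ.* d) ]q

        -- This is where the base p = q^s matters: the extra q of `shifted` and the p^d of the
        -- Pascal rule make up exactly the shift of exponents.
        q^[1+sd] : q ^ (1 ℕ.+ s ℕ.* d) ≈ q * p ^ d
        q^[1+sd] = *-congˡ (sym (^-assocʳ q s d))

        zpow-exponent : q^ exponent (suc n) (ℤ.suc k) ≈ q * p ^ d * a
        zpow-exponent = trans (reflexive (≡.cong q^_ (exponent-shift k r≤n)))
          (trans (zpow-+ (1 ℕ.+ s ℕ.* d) (exponent r k)) (*-congʳ q^[1+sd]))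

        qNumber-exponent : [ exponent (suc n) (ℤ.suc (ℤ.suc k)) ]q ≈ e + q * p ^ d * b
        qNumber-exponent = trans (reflexive (≡.cong [_]q (exponent-shift (ℤ.suc k) r≤n)))
          (trans (qNumber-+ (1 ℕ.+ s ℕ.* d) (exponent r (ℤ.suc k)))
                 (+-congˡ (*-congʳ q^[1+sd])))

      -- The coefficients in `term-recurrence` are free of `r`, so they leave the sum; they are
      -- those of the recurrence of S for row n + 2 and column k + 2.
      ∑-term-recurrence : ∀ n → ∑< (suc (suc n)) (term Y (suc n)) ≈
        q^ exponent (suc n) (ℤ.suc k) * ∑< (suc n) (term X n)
        + h * [ exponent (suc n) (ℤ.suc (ℤ.suc k)) ]q * ∑< (suc n) (term Y n)
      ∑-term-recurrence n = begin
        ∑< (suc (suc n)) (term Y (suc n))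
          ≈⟨ ∑-term-suc Y n ⟩
        ∑< (suc n) (λ r → shifted Y n r + unshifted Y n r)
          ≈⟨ ∑<-cong (suc n) (λ r r<1+n → term-recurrence (ℕ.s≤s⁻¹ r<1+n)) ⟩
        ∑< (suc n) (λ r → α * term X n r + β * term Y n r)
          ≈⟨ ∑-distrib-+ {suc n} (λ i → α * term X n (toℕ i)) (λ i → β * term Y n (toℕ i)) ⟩
        ∑< (suc n) (λ r → α * term X n r) + ∑< (suc n) (λ r → β * term Y n r)
          ≈⟨ +-cong (*-distribˡ-sum {suc n} α (term X n ∘ toℕ))
                    (*-distribˡ-sum {suc n} β (term Y n ∘ toℕ)) ⟨
        α * ∑< (suc n) (term X n) + β * ∑< (suc n) (term Y n)
          ∎
        where
        α = q^ exponent (suc n) (ℤ.suc k)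
        β = h * [ exponent (suc n) (ℤ.suc (ℤ.suc k)) ]q

    -- The identity for the columns of S.

    S-> : ∀ {n k} → n ℕ.< k → S n k ≈ 0#
    S-> {zero}  {suc k} _ = refl
    S-> {suc n} {suc k} (s≤s n<k) = trans
      (+-cong (*-congˡ (S-> n<k)) (*-congˡ (S-> (ℕₚ.m<n⇒m<1+n n<k))))
      (solve 2 (λ a b → a :* con 0 :+ b :* con 0 := con 0) refl _ _)

    term-zero : ∀ {f n r} → f r ≈ 0# → term f n r ≈ 0#
    term-zero fr≈0 = trans (*-congʳ (trans (*-congˡ fr≈0) (zeroʳ _))) (zeroˡ _)

    exponent-0-0 : exponent 0 (+ 0) ≡ + 0
    exponent-0-0 = ≡.cong₂ ℤ._-_ (ℤₚ.*-zeroʳ (+ s)) (ℤₚ.*-zeroʳ (+ s ℤ.- + 1))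

    -- Column 0 obeys the recurrence with a zero column to its left: at r = 0 the q-number is [0]_q
    -- = 0, and for r > 0 the entry `S r 0` is 0.
    S-column-zero : ∀ r → S (suc r) 0 ≈
      q^ exponent r -[1+ 0 ] * 0# + h * [ exponent r (+ 0) ]q * S r 0
    S-column-zero zero    = begin
      0#
        ≈⟨ solve 2 (λ a h → a :* con 0 :+ h :* con 0 :* con 1 := con 0) refl _ h ⟨
      q^ exponent 0 -[1+ 0 ] * 0# + h * 0# * 1#
        ≈⟨ +-congˡ (*-congʳ (*-congˡ
             (trans (reflexive (≡.cong [_]q exponent-0-0)) (qNumber-zero q≟1)))) ⟨
      q^ exponent 0 -[1+ 0 ] * 0# + h * [ exponent 0 (+ 0) ]q * 1# ∎
    S-column-zero (suc r) =
      sym (solve 2 (λ a b → a :* con 0 :+ b :* con 0 := con 0) refl _ _)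

    -- `S 0 (suc k)` vanishes. The power of q is q^0 for k = 0, and for k > 0 it multiplies a zero
    -- entry.
    S-one-suc : ∀ k → S 1 (suc k) ≈ S 0 k
    S-one-suc k = trans (+-congˡ (zeroʳ _)) (trans (+-identityʳ _) (unit k))
      where
      unit : ∀ k → q^ exponent 0 (+ k) * S 0 k ≈ S 0 k
      unit zero    = trans (*-congʳ (reflexive (≡.cong q^_ exponent-0-0))) (*-identityˡ _)
      unit (suc k) = zeroʳ _

    -- Induction on n for all columns at once. Starting at r = 0 rather than r = k adds only zero
    -- terms and gives neighbouring columns the same range.
    S-column : ∀ n k → S (suc n) (suc k) ≈ ∑< (suc n) (term (λ r → S r k) n)
    S-column zero k = trans (S-one-suc k)
      (solve 1 (λ x → x := con 1 :* con 1 :* con 1 :* x :* con 1 :+ con 0) refl (S 0 k))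
    S-column (suc n) zero = begin
      q^ exponent (suc n) (+ 0) * 0# + h * [ exponent (suc n) (+ 1) ]q * S (suc n) 1
        -- The entry in column 0 is 0, rewritten as the sum for a zero column so that the recurrence
        -- applies at k = -1.
        ≈⟨ +-cong (*-congˡ (sym (∑<-zero (suc n) (λ r → term-zero {λ _ → 0#} {n} {r} refl))))
                  (*-congˡ (S-column n 0)) ⟩
      q^ exponent (suc n) (+ 0) * ∑< (suc n) (term (λ _ → 0#) n)
      + h * [ exponent (suc n) (+ 1) ]q * ∑< (suc n) (term (λ r → S r 0) n)
        ≈⟨ ∑-term-recurrence (λ _ → 0#) (λ r → S r 0) -[1+ 0 ] S-column-zero n ⟨
      ∑< (suc (suc n)) (term (λ r → S r 0) (suc n))
        ∎
    S-column (suc n) (suc k) = begin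
      q^ exponent (suc n) (+ suc k) * S (suc n) (suc k)
      + h * [ exponent (suc n) (+ suc (suc k)) ]q * S (suc n) (suc (suc k))
        ≈⟨ +-cong (*-congˡ (S-column n k)) (*-congˡ (S-column n (suc k))) ⟩
      q^ exponent (suc n) (+ suc k) * ∑< (suc n) (term (λ r → S r k) n)
      + h * [ exponent (suc n) (+ suc (suc k)) ]q * ∑< (suc n) (term (λ r → S r (suc k)) n)
        -- The hypothesis on the two columns is the defining recurrence of S, hence `refl`.
        ≈⟨ ∑-term-recurrence (λ r → S r k) (λ r → S r (suc k)) (+ k) (λ _ → refl) n ⟨
      ∑< (suc (suc n)) (term (λ r → S r (suc k)) (suc n))
        ∎

    -- Summation over the columns.

    B-suc : ∀ n → B (suc n) ≈ ∑< (suc n) (term B n)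
    B-suc n = begin
      -- The leading zero is the entry of column 0.
      0# + ∑< (suc n) (λ k → S (suc n) (suc k))
        ≈⟨ +-identityˡ _ ⟩
      ∑< (suc n) (λ k → S (suc n) (suc k))
        ≈⟨ ∑<-cong (suc n) (λ k _ → S-column n k) ⟩
      ∑< (suc n) (λ k → ∑< (suc n) (term (λ r → S r k) n))
        ≈⟨ ∑-comm {suc n} {suc n} (λ k r → term (λ r → S r (toℕ k)) n (toℕ r)) ⟩
      ∑< (suc n) (λ r → ∑< (suc n) (λ k → term (λ r → S r k) n r))
        ≈⟨ ∑<-cong (suc n) (λ r r≤n → row r (ℕ.s≤s⁻¹ r≤n)) ⟩
      ∑< (suc n) (term B n)
        ∎
      where
      row : ∀ r → r ℕ.≤ n → ∑< (suc n) (λ k → term (λ r → S r k) n r) ≈ term B n r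
      row r r≤n = begin
        ∑< (suc n) (λ k → a * S r k * P (n ∸ r))
          ≈⟨ *-distribʳ-sum {suc n} (P (n ∸ r)) (λ k → a * S r (toℕ k)) ⟨
        ∑< (suc n) (λ k → a * S r k) * P (n ∸ r)
          ≈⟨ *-congʳ (*-distribˡ-sum {suc n} a (λ k → S r (toℕ k))) ⟨
        a * ∑< (suc n) (S r) * P (n ∸ r)
          -- Interchanging the sums required the range k ≤ n for every r; `B r` stops at k = r,
          -- beyond which `S r k` vanishes.
          ≈⟨ *-congʳ (*-congˡ (∑<-truncate (S r) (s≤s r≤n) (λ _ → S->))) ⟩
        a * B r * P (n ∸ r)
          ∎
        where a = h ^ (n ∸ r) * q ^ r * G n r

    -- Passage to the indexing of the theorem.

    term-∸1 : ∀ f n r → term f n r ≈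
      h ^ (suc n ∸ r ∸ 1) * q ^ r * G n r * f r * P (suc n ∸ r ∸ 1)
    term-∸1 f n r = reflexive (≡.cong
      (λ m → h ^ m * q ^ r * G n r * f r * P m)
      (≡.sym (≡.trans (ℕₚ.∸-+-assoc (suc n) r 1) (≡.cong (suc n ∸_) (ℕₚ.+-comm r 1)))))

    S-column-∑ : ∀ n k → 1 ℕ.≤ n → 1 ℕ.≤ k →
      S n k ≈ ∑[ k ∸ 1 ≤ r < n ]
        (h ^ (n ∸ r ∸ 1) * q ^ r * G (n ∸ 1) r * S r (k ∸ 1) * P (n ∸ r ∸ 1))
    S-column-∑ (suc n) (suc k) _ _ = begin
      S (suc n) (suc k)
        ≈⟨ S-column n k ⟩
      ∑< (suc n) (term f n)
        -- Entries `S r k` with r < k vanish, so the sum may start at r = k.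
        ≈⟨ ∑<-drop k (suc n) (term f n) (λ r r<k → term-zero {f} {n} {r} (S-> r<k)) ⟩
      ∑[ k ≤ r < suc n ] term f n r
        ≈⟨ ∑<-cong (suc n ∸ k) {term f n ∘ (k ℕ.+_)} (λ r _ → term-∸1 f n (k ℕ.+ r)) ⟩
      _ ∎
      where
      f : ℕ → Carrier
      f r = S r k

    B-∑ : ∀ n → 1 ℕ.≤ n →
      B n ≈ ∑[ 0 ≤ r < n ]
        (h ^ (n ∸ r ∸ 1) * q ^ r * G (n ∸ 1) r * B r * P (n ∸ r ∸ 1))
    B-∑ (suc n) _ = trans (B-suc n) (∑<-cong (suc n) {term B n} (λ r _ → term-∸1 B n r))

theorem16 : ∀ {c ℓ₁ ℓ₂} (K : HeytingField c ℓ₁ ℓ₂) → let open HeytingField K in let open OverField K in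
    (s : ℕ) (h q : Carrier) → h # 0# → (q#0 : q # 0#) (q≟1 : q ≈ 1# ⊎ q # 1#) →
    let open GeneralizedStirling s h q q#0 q≟1 in
    (∀ n k → 1 ℕ.≤ n → 1 ℕ.≤ k →
    S n k ≈ ∑[ k ∸ 1 ≤ r < n ]
    (h ^ (n ∸ r ∸ 1) * q ^ r * gaussian (q ^ s) (n ∸ 1) r * S r (k ∸ 1)
    * ∏[ i < n ∸ r ∸ 1 ] [ + (1 ℕ.+ s ℕ.* i) ]q))
    ×
    (∀ n → 1 ℕ.≤ n →
    B n ≈ ∑[ 0 ≤ r < n ]
    (h ^ (n ∸ r ∸ 1) * q ^ r * gaussian (q ^ s) (n ∸ 1) r * B r
    * ∏[ i < n ∸ r ∸ 1 ] [ + (1 ℕ.+ s ℕ.* i) ]q))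
theorem16 K s h q _ q#0 q≟1 = S-column-∑ , B-∑
  where open StirlingRecurrence.Column K s h q q#0 q≟1
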